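{- Let $l\geq 1$ and $k\geq 5$ be integers. Let $T'$ be a strong tournament on the vertices $\{1,2,\ldots,l\}$, and let $T_1,T_2,\ldots,T_l$ be regular or near regular tournaments of order $k$. Construct a tournament $T$ on $kl$ vertices as follows: let $V$ be a set of $kl$ vertices, partition $V$ into $l$ subsets $V_1,\ldots,V_l$ of size $k$, place arcs inside $V_1,\ldots,V_l$ to form copies of $T_1,T_2,\ldots,T_l$ respectively, and finally add arcs so that every vertex of $V_i$ dominates every vertex of $V_j$ if and only if $i\rightarrow j$ in $T'$. Then the resulting tournament $T$ is strongly quadrangular.
   Context: A tournament $T$ is a directed graph (no loops) such that for each pair of distinct vertices $u,v$ exactly one of $(u,v)$, $(v,u)$ is an arc; $u\rightarrow v$ ($u$ dominates $v$) means $(u,v)$ is an arc. A tournament is strong if it is strongly connected. The order of a tournament is its number of vertices. For a vertex $v$, $O(v)=\{u: v\rightarrow u\}$ and $I(v)=\{u: u\rightarrow v\}$; the out-degree of $v$ is $|O(v)|$. A tournament is regular if all vertices have the same out-degree, and near regular if the largest difference between the out-degrees of any two vertices is $1$. A digraph $D$ is strongly quadrangular if the following two conditions hold. (i) For every $S\subseteq V(D)$ such that for all $u\in S$ there exists $v\in S$, $v\neq u$, with $O(u)\cap O(v)\neq\emptyset$, one has $\left|\bigcup_{u,v\in S,\,u\neq v}(O(u)\cap O(v))\right|\geq |S|$. (ii) For every $S'\subseteq V(D)$ such that for all $u\in S'$ there exists $v\in S'$, $v\neq u$, with $I(u)\cap I(v)\neq\emptyset$, one has $\left|\bigcup_{u,v\in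 S',\,u\neq v}(I(u)\cap I(v))\right|\geq |S'|$.
   Formalization: The condition l ≥ 1 is replaced by l ≥ 2, since for l = 1 the claim is false: the regular tournament u → u+1, u+2 (mod 5) with S = {0,1} has only one common out-neighbour, and similar failures occur for every k ≥ 5. -}

module Defs where

open import Data.Fin using (Fin)
open import Data.Fin.Properties using (_≟_)
open import Data.Fin.Subset using (Subset; _∈_; _∩_; ⋃; ∣_∣; Nonempty)
open import Data.Fin.Subset.Properties using (_∈?_)
open import Data.List using (List; map; filter; allFin; cartesianProduct)
open import Data.Nat using (ℕ; _≤_; _≥_; _*_; ∣_-_∣)
open import Data.Product using (_×_; _,_; proj₁; proj₂; ∃; ∃₂)
open import Data.Sum using (_⊎_)
open import Data.Vec using (tabulate)
open import Function.Bundles using (_⇔_)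
open import Function.Definitions using (Injective)
open import Relation.Binary using (Rel; Decidable; Irreflexive)
open import Relation.Binary.Construct.Closure.ReflexiveTransitive using (Star)
open import Relation.Binary.PropositionalEquality using (_≡_; _≢_)
open import Relation.Nullary using (¬_; does; ¬?; _×-dec_)
open import Level using (0ℓ)

record Digraph (n : ℕ) : Set₁ where
  infix 4 _⟶_ _⟶?_
  field
    _⟶_  : Rel (Fin n) 0ℓ
    _⟶?_ : Decidable _⟶_

  O : Fin n → Subset n
  O v = tabulate λ u → does (v ⟶? u)

  I : Fin n → Subset n
  I v = tabulate λ u → does (u ⟶? v)

  outDegree : Fin n → ℕ
  outDegree v = ∣ O v ∣

open Digraph public using (O; I; outDegree)

record IsTournament {n : ℕ} (D : Digraph n) : Set where
  open Digraph D using (_⟶_)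
  field
    loopless   : Irreflexive _≡_ _⟶_
    exactlyOne : ∀ {u v} → u ≢ v →
                 (u ⟶ v × ¬ (v ⟶ u)) ⊎ (v ⟶ u × ¬ (u ⟶ v))

Strong : ∀ {n} → Digraph n → Set
Strong D = ∀ u v → Star (Digraph._⟶_ D) u v

Regular : ∀ {n} → Digraph n → Set
Regular D = ∀ u v → outDegree D u ≡ outDegree D v

-- The maximum of the differences is 1: it is an upper bound and is attained.
NearRegular : ∀ {n} → Digraph n → Set
NearRegular D =
  (∀ u v → ∣ outDegree D u - outDegree D v ∣ ≤ 1) ×
  (∃₂ λ u v → ∣ outDegree D u - outDegree D v ∣ ≡ 1)

distinctPairs : ∀ {n} → Subset n → List (Fin n × Fin n)
distinctPairs {n} S =
  filter (λ p → (proj₁ p ∈? S) ×-dec (proj₂ p ∈? S) ×-dec ¬? (proj₁ p ≟ proj₂ p))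
         (cartesianProduct (allFin n) (allFin n))

-- The two conditions of strong quadrangularity are the instances N = O and
-- N = I of this one.
Quadrangular : ∀ {n} → (Fin n → Subset n) → Set
Quadrangular {n} N =
  (S : Subset n) →
  (∀ u → u ∈ S → ∃ λ v → v ∈ S × v ≢ u × Nonempty (N u ∩ N v)) →
  ∣ ⋃ (map (λ (u , v) → N u ∩ N v) (distinctPairs S)) ∣ ≥ ∣ S ∣

StronglyQuadrangular : ∀ {n} → Digraph n → Set
StronglyQuadrangular D = Quadrangular (O D) × Quadrangular (I D)

-- The partition is given by its class map, so V i is the fibre of `block` over
-- i.  By the first three `copy` fields, copy i is a bijection from the vertices
-- of Ts i onto V i; in particular every V i has exactly k elements.
record IsComposition {l k : ℕ} (T′ : Digraph l) (Ts : Fin l → Digraph k)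
                     (T : Digraph (k * l)) : Set where
  open Digraph T  using (_⟶_)
  open Digraph T′ using () renaming (_⟶_ to _⟶′_)
  field
    block          : Fin (k * l) → Fin l
    copy           : Fin l → Fin k → Fin (k * l)
    copy-block     : ∀ i a → block (copy i a) ≡ i
    copy-injective : ∀ i → Injective _≡_ _≡_ (copy i)
    copy-onto      : ∀ v → ∃ λ a → copy (block v) a ≡ v
    inside         : ∀ i a b → (copy i a ⟶ copy i b) ⇔ Digraph._⟶_ (Ts i) a b
    across         : ∀ u v → block u ≢ block v → (u ⟶ v) ⇔ (block u ⟶′ block v)

{-# OPTIONS --safe #-}

-- Write S_j and Q_j for the parts of S and of the union Q of pairwise common
-- out-neighbourhoods that lie in V_j.  If i → j in T′ and S_i is nonempty, then
-- Q_j contains every out-neighbour in T_j of S_j, and near regularity makes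
-- these at least |S_j| many; if |S_i| ≥ 2, then Q_j is all of V_j.  Hence
-- |S_j| ≤ |Q_j| except possibly for one j₀ with S_j₀ nonempty, namely a class
-- dominated by no class that meets S.  Such a j₀ dominates all other classes
-- that meet S.  Strength of T′ provides an arc leaving these classes (if
-- |S_j₀| = 1) or leaving O(j₀) (if |S_j₀| ≥ 2), and one end of that arc is a
-- class j₁ ≠ j₀ with |S_j₀| + |S_j₁| ≤ |Q_j₀| + |Q_j₁|.  Reversing all arcs
-- gives the condition on in-neighbourhoods.
module Submission where

open import Defs
import Algebra.Properties.CommutativeMonoid.Sum
open import Data.Bool using (Bool; true; false; if_then_else_)
open import Data.Fin using (Fin; zero; suc; punchIn; punchOut; combine; remQuot; _↑ˡ_; _↑ʳ_)
open import Data.Fin.Permutation using (Permutation)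
open import Data.Fin.Properties
  using (_≟_; any?; punchInᵢ≢i; punchIn-punchOut; *↔×; remQuot-combine)
open import Data.Fin.Subset hiding (inside; outside)
open import Data.Fin.Subset.Properties
open import Data.List using (List; _∷_; map)
open import Data.List.Membership.Propositional using () renaming (_∈_ to _∈ˡ_)
open import Data.List.Membership.Propositional.Properties
  using (∈-allFin; ∈-cartesianProduct⁺; ∈-filter⁺; ∈-map⁺)
open import Data.List.Relation.Unary.Any using (here; there)
open import Data.Nat using (ℕ; zero; suc; _+_; _*_; _∸_; _≤_; _<_; z≤n; s≤s; s≤s⁻¹; _≤?_)
open import Data.Nat.Properties hiding (_≟_)
open import Data.Product using (_×_; _,_; proj₁; proj₂; ∃; ∃₂)
open import Data.Sum using (_⊎_; inj₁; inj₂; [_,_]′; swap)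
open import Data.Vec using (_∷_; tabulate; lookup; there)
open import Data.Vec.Properties using (lookup∘tabulate; tabulate∘lookup; lookup⇒[]=; []=⇒lookup)
open import Function using (_∘_; id; flip)
open import Function.Bundles using (mk↔ₛ′; Equivalence)
open import Function.Construct.Composition using (_↔-∘_)
open import Level using (0ℓ)
open import Relation.Binary using (Rel)
open import Relation.Binary.Construct.Closure.ReflexiveTransitive using (Star; ε; _◅_; reverse)
open import Relation.Binary.PropositionalEquality
open import Relation.Nullary
open import Relation.Nullary.Decidable using (dec-true; decidable-stable)
open import Relation.Unary using (Pred) renaming (Decidable to Decidable₁)

open Algebra.Properties.CommutativeMonoid.Sum +-0-commutativeMonoid
  using (sum; sum-cong-≗; sum-remove; sum-permute; ∑-comm)

private variable
  m n : ℕ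

-- Inequalities between finite sums

sum-mono : {f g : Fin n → ℕ} → (∀ j → f j ≤ g j) → sum f ≤ sum g
sum-mono {zero}  f≤g = z≤n
sum-mono {suc n} f≤g = +-mono-≤ (f≤g zero) (sum-mono (f≤g ∘ suc))

-- The slacks `x` and `y` enter at the single index `i`. Taking 1 and 0 yields a strict inequality;
-- taking the terms of a second index yields `sum-mono-pair`.
sum-mono-at : {f g : Fin n → ℕ} (i : Fin n) {x y : ℕ} →
  (∀ j → j ≢ i → f j ≤ g j) → f i + x ≤ g i + y → sum f + x ≤ sum g + y
sum-mono-at {suc n} {f} {g} i {x} {y} f≤g fi≤gi = begin
  sum f + x         ≡⟨ cong (_+ x) (trans (sum-remove {i = i} f) (+-comm (f i) _)) ⟩
  f′ + f i + x      ≡⟨ +-assoc f′ (f i) x ⟩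
  f′ + (f i + x)    ≤⟨ +-mono-≤ (sum-mono λ j → f≤g (punchIn i j) (punchInᵢ≢i i j)) fi≤gi ⟩
  g′ + (g i + y)    ≡⟨ +-assoc g′ (g i) y ⟨
  g′ + g i + y      ≡⟨ cong (_+ y) (trans (sum-remove {i = i} g) (+-comm (g i) _)) ⟨
  sum g + y         ∎
  where
  open ≤-Reasoning
  f′ = sum (f ∘ punchIn i)
  g′ = sum (g ∘ punchIn i)

-- Index `a` is removed and its two terms become the slacks at `b`. Thus `f` may exceed `g` at `a`
-- as long as `b` makes up for it.
sum-mono-pair : {f g : Fin n → ℕ} {a b : Fin n} → b ≢ a →
  (∀ j → j ≢ a → f j ≤ g j) → f a + f b ≤ g a + g b → sum f ≤ sum g
sum-mono-pair {suc n} {f} {g} {a} {b} b≢a f≤g pair = begin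
  sum f         ≡⟨ trans (sum-remove {i = a} f) (+-comm (f a) _) ⟩
  sum f′ + f a  ≤⟨ sum-mono-at b′ (λ j _ → f≤g (punchIn a j) (punchInᵢ≢i a j)) pair′ ⟩
  sum g′ + g a  ≡⟨ trans (sum-remove {i = a} g) (+-comm (g a) _) ⟨
  sum g         ∎
  where
  open ≤-Reasoning
  f′ = f ∘ punchIn a
  g′ = g ∘ punchIn a
  b′ = punchOut (b≢a ∘ sym)
  pair′ : f′ b′ + f a ≤ g′ b′ + g a
  pair′ = subst (λ c → f c + f a ≤ g c + g a) (sym (punchIn-punchOut (b≢a ∘ sym)))
            (subst₂ _≤_ (+-comm (f a) (f b)) (+-comm (g a) (g b)) pair)

sum-+ : ∀ m {n} (f : Fin (m + n) → ℕ) → sum f ≡ sum (f ∘ (_↑ˡ n)) + sum (f ∘ (m ↑ʳ_))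
sum-+ zero    f = refl
sum-+ (suc m) f = trans (cong (f zero +_) (sum-+ m (f ∘ suc))) (sym (+-assoc (f zero) _ _))

sum-* : ∀ m {n} (f : Fin (m * n) → ℕ) → sum f ≡ sum (λ i → sum (λ j → f (combine {m} {n} i j)))
sum-* zero        f = refl
sum-* (suc m) {n} f =
  trans (sum-+ n f) (cong (sum (f ∘ (_↑ˡ m * n)) +_) (sum-* m (f ∘ (n ↑ʳ_))))

-- Cardinalities of finite subsets

indicator : Bool → ℕ
indicator b = if b then 1 else 0

∣tabulate∣≡sum : (f : Fin n → Bool) → ∣ tabulate f ∣ ≡ sum (indicator ∘ f)
∣tabulate∣≡sum {zero}  f = refl
∣tabulate∣≡sum {suc n} f with f zero
... | true  = cong suc (∣tabulate∣≡sum (f ∘ suc))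
... | false = ∣tabulate∣≡sum (f ∘ suc)

∈-tabulate⁺ : {f : Fin n → Bool} {x : Fin n} → f x ≡ true → x ∈ tabulate f
∈-tabulate⁺ {f = f} {x} fx = lookup⇒[]= x _ (trans (lookup∘tabulate f x) fx)

∈-tabulate⁻ : {f : Fin n → Bool} {x : Fin n} → x ∈ tabulate f → f x ≡ true
∈-tabulate⁻ {f = f} {x} x∈ = trans (sym (lookup∘tabulate f x)) ([]=⇒lookup x∈)

does-true⁻ : {A : Set} (a? : Dec A) → does a? ≡ true → A
does-true⁻ (yes a) _ = a

∣p∣≤1+∣p-x∣ : (p : Subset n) (x : Fin n) → ∣ p ∣ ≤ suc ∣ p - x ∣
∣p∣≤1+∣p-x∣ (true  ∷ p) zero    = s≤s (≤-reflexive (cong ∣_∣ (sym (p─⊥≡p p))))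
∣p∣≤1+∣p-x∣ (false ∷ p) zero    = m≤n⇒m≤1+n (≤-reflexive (cong ∣_∣ (sym (p─⊥≡p p))))
∣p∣≤1+∣p-x∣ (true  ∷ p) (suc x) = s≤s (∣p∣≤1+∣p-x∣ p x)
∣p∣≤1+∣p-x∣ (false ∷ p) (suc x) = ∣p∣≤1+∣p-x∣ p x

x∉p-x : (p : Subset n) (x : Fin n) → x ∉ p - x
x∉p-x (true  ∷ p) zero ()
x∉p-x (false ∷ p) zero ()
x∉p-x (_ ∷ p) (suc x) (there x∈) = x∉p-x p x x∈

x∈p-y⁻ : (p : Subset n) {x y : Fin n} → x ∈ p - y → x ∈ p × x ≢ y
x∈p-y⁻ p {y = y} x∈ = p─q⊆p p ⁅ y ⁆ x∈ , λ { refl → x∉p-x p y x∈ }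

0<∣p∣⇒Nonempty : (p : Subset n) → 1 ≤ ∣ p ∣ → Nonempty p
0<∣p∣⇒Nonempty {n} p 1≤ with nonempty? p
... | yes ne = ne
... | no  e  = contradiction 1≤
  (<⇒≱ (s≤s (≤-reflexive (trans (cong ∣_∣ (Empty-unique e)) (∣⊥∣≡0 n)))))

1<∣p∣⇒distinct : (p : Subset n) → 2 ≤ ∣ p ∣ → ∃₂ λ x y → x ∈ p × y ∈ p × x ≢ y
1<∣p∣⇒distinct p 2≤ =
  let x , x∈  = 0<∣p∣⇒Nonempty p (≤-trans (s≤s z≤n) 2≤)
      y , y∈′ = 0<∣p∣⇒Nonempty (p - x) (s≤s⁻¹ (≤-trans 2≤ (∣p∣≤1+∣p-x∣ p x)))
      y∈ , y≢x = x∈p-y⁻ p y∈′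
  in x , y , x∈ , y∈ , y≢x ∘ sym

x∈p⇒0<∣p∣ : {p : Subset n} {x : Fin n} → x ∈ p → 1 ≤ ∣ p ∣
x∈p⇒0<∣p∣ x∈p = ≤-trans (s≤s z≤n) (x∈p⇒∣p-x∣<∣p∣ x∈p)

distinct⇒1<∣p∣ : {p : Subset n} {x y : Fin n} → x ∈ p → y ∈ p → x ≢ y → 2 ≤ ∣ p ∣
distinct⇒1<∣p∣ x∈ y∈ x≢y =
  ≤-trans (s≤s (x∈p⇒0<∣p∣ (x∈p∧x≢y⇒x∈p-y x∈ x≢y))) (x∈p⇒∣p-x∣<∣p∣ y∈)

-- Unions over pairs, and paths leaving a set

∈-⋃⁺ : {ps : List (Subset n)} {p : Subset n} {x : Fin n} → p ∈ˡ ps → x ∈ p → x ∈ ⋃ ps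
∈-⋃⁺ {ps = q ∷ qs} (here refl) x∈ = p⊆p∪q (⋃ qs) x∈
∈-⋃⁺ {ps = q ∷ qs} (there p∈)  x∈ = q⊆p∪q q (⋃ qs) (∈-⋃⁺ p∈ x∈)

∈-distinctPairs⁺ : {S : Subset n} {u v : Fin n} → u ∈ S → v ∈ S → u ≢ v → (u , v) ∈ˡ distinctPairs S
∈-distinctPairs⁺ {S = S} u∈ v∈ u≢v =
  ∈-filter⁺ (λ p → (proj₁ p ∈? S) ×-dec (proj₂ p ∈? S) ×-dec ¬? (proj₁ p ≟ proj₂ p))
    (∈-cartesianProduct⁺ (∈-allFin _) (∈-allFin _)) (u∈ , v∈ , u≢v)

-- The arc sought enters the first vertex of the path outside `P`. Strength of `T′` is always used
-- in this form.
Star-exit : {A : Set} {R : Rel A 0ℓ} {P : Pred A 0ℓ} → Decidable₁ P → ∀ {x y} →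
  Star R x y → P x → ¬ P y → ∃₂ λ a b → R a b × P a × ¬ P b
Star-exit P? ε px ¬py = contradiction px ¬py
Star-exit P? (_◅_ {j = z} r rs) px ¬py with P? z
... | yes pz = Star-exit P? rs pz ¬py
... | no ¬pz = _ , _ , r , px , ¬pz

another : 2 ≤ n → (i : Fin n) → ∃ λ j → j ≢ i
another (s≤s (s≤s _)) i = punchIn i zero , punchInᵢ≢i i zero

-- Reversal of arcs

op : Digraph n → Digraph n
op D = record { _⟶_ = flip (Digraph._⟶_ D) ; _⟶?_ = flip (Digraph._⟶?_ D) }

op-isTournament : {D : Digraph n} → IsTournament D → IsTournament (op D)
op-isTournament t = record
  { loopless   = λ eq → loopless (sym eq)
  ; exactlyOne = λ u≢v → swap (exactlyOne u≢v)
  } where open IsTournament t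

op-strong : (D : Digraph n) → Strong D → Strong (op D)
op-strong D strong u v = reverse id (strong v u)

op-isComposition : ∀ {l k} {T′ : Digraph l} {Ts : Fin l → Digraph k} {T : Digraph (k * l)} →
  IsComposition T′ Ts T → IsComposition (op T′) (op ∘ Ts) (op T)
op-isComposition c = record
  { block          = block
  ; copy           = copy
  ; copy-block     = copy-block
  ; copy-injective = copy-injective
  ; copy-onto      = copy-onto
  ; inside         = λ i a b → inside i b a
  ; across         = λ u v ne → across v u (ne ∘ sym)
  } where open IsComposition c

-- Degrees in balanced tournaments

∈-O⁺ : (D : Digraph n) {u v : Fin n} → Digraph._⟶_ D u v → v ∈ O D u
∈-O⁺ D a = ∈-tabulate⁺ (dec-true (Digraph._⟶?_ D _ _) a)

∈-O⁻ : (D : Digraph n) {u v : Fin n} → v ∈ O D u → Digraph._⟶_ D u v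
∈-O⁻ D v∈ = does-true⁻ (Digraph._⟶?_ D _ _) (∈-tabulate⁻ v∈)

-- A common weakening of regularity and near regularity that, for tournaments, survives reversal.
Balanced : Digraph n → Set
Balanced D = ∀ u v → outDegree D u ≤ suc (outDegree D v)

regular⇒balanced : (D : Digraph n) → Regular D ⊎ NearRegular D → Balanced D
regular⇒balanced D (inj₁ reg) u v = m≤n⇒m≤1+n (≤-reflexive (reg u v))
regular⇒balanced D (inj₂ (near , _)) u v = ≤-trans (m≤n+∣m-n∣ _ _)
  (≤-trans (+-monoʳ-≤ (outDegree D v) (near u v)) (≤-reflexive (+-comm _ 1)))

module _ (D : Digraph n) (tour : IsTournament D) where
  open Digraph D using (_⟶_; _⟶?_)
  open IsTournament tour

  total : ∀ {u v} → u ≢ v → (u ⟶ v) ⊎ (v ⟶ u)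
  total u≢v = [ inj₁ ∘ proj₁ , inj₂ ∘ proj₁ ]′ (exactlyOne u≢v)

  arc⇒≢ : ∀ {u v} → u ⟶ v → u ≢ v
  arc⇒≢ a refl = loopless refl a

  asym : ∀ {u v} → u ⟶ v → ¬ (v ⟶ u)
  asym a b = [ (λ p → proj₂ p b) , (λ p → proj₂ p a) ]′ (exactlyOne (arc⇒≢ a))

  -- In a tournament the in-neighbours of `v` are exactly the vertices other than `v` outside
  -- `O D v`. In-degrees are written `outDegree (op D)`.
  outDegree+inDegree : ∀ v → outDegree D v + suc (outDegree (op D) v) ≡ n
  outDegree+inDegree v = begin
    outDegree D v + suc (outDegree (op D) v)   ≡⟨ cong (λ d → outDegree D v + suc d) ∣I∣ ⟩
    outDegree D v + suc ∣ ∁ (O D v) - v ∣      ≡⟨ cong (outDegree D v +_) ∣∁O∣ ⟩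
    outDegree D v + ∣ ∁ (O D v) ∣              ≡⟨ cong (outDegree D v +_) (∣∁p∣≡n∸∣p∣ (O D v)) ⟩
    outDegree D v + (n ∸ outDegree D v)        ≡⟨ m+[n∸m]≡n (∣p∣≤n (O D v)) ⟩
    n                                          ∎
    where
    open ≡-Reasoning
    v∈∁O : v ∈ ∁ (O D v)
    v∈∁O = x∉p⇒x∈∁p (loopless refl ∘ ∈-O⁻ D)
    ∣∁O∣ : suc ∣ ∁ (O D v) - v ∣ ≡ ∣ ∁ (O D v) ∣
    ∣∁O∣ = ≤-antisym (x∈p⇒∣p-x∣<∣p∣ v∈∁O) (∣p∣≤1+∣p-x∣ (∁ (O D v)) v)
    I⊆ : O (op D) v ⊆ ∁ (O D v) - v
    I⊆ u∈ = let a = ∈-O⁻ (op D) u∈ in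
      x∈p∧x≢y⇒x∈p-y (x∉p⇒x∈∁p (asym a ∘ ∈-O⁻ D)) (arc⇒≢ a)
    ⊆I : ∁ (O D v) - v ⊆ O (op D) v
    ⊆I u∈ with x∈p-y⁻ (∁ (O D v)) u∈
    ... | u∈∁ , u≢v with total u≢v
    ...   | inj₁ a = ∈-O⁺ (op D) a
    ...   | inj₂ a = contradiction (∈-O⁺ D a) (x∈∁p⇒x∉p u∈∁)
    ∣I∣ : outDegree (op D) v ≡ ∣ ∁ (O D v) - v ∣
    ∣I∣ = ≤-antisym (p⊆q⇒∣p∣≤∣q∣ I⊆) (p⊆q⇒∣p∣≤∣q∣ ⊆I)

  -- Out-degree and in-degree have constant sum, so a gap between in-degrees is the opposite gap
  -- between out-degrees.
  op-balanced : Balanced D → Balanced (op D)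
  op-balanced bal u v = s≤s⁻¹ (+-cancelˡ-≤ (outDegree D u) _ _ (begin
    outDegree D u + suc (outDegree (op D) u)        ≡⟨ outDegree+inDegree u ⟩
    n                                               ≡⟨ outDegree+inDegree v ⟨
    outDegree D v + suc (outDegree (op D) v)        ≤⟨ +-monoˡ-≤ _ (bal v u) ⟩
    suc (outDegree D u) + suc (outDegree (op D) v)  ≡⟨ +-suc (outDegree D u) _ ⟨
    outDegree D u + suc (suc (outDegree (op D) v))  ∎))
    where open ≤-Reasoning

  -- Both sides count all arcs, by tail and by head.
  handshake : sum (outDegree D) ≡ sum (outDegree (op D))
  handshake = begin
    sum (outDegree D)                                    ≡⟨ sum-cong-≗ (λ v → ∣tabulate∣≡sum (λ u → does (v ⟶? u))) ⟩
    sum (λ v → sum (λ u → indicator (does (v ⟶? u))))    ≡⟨ ∑-comm (λ v u → indicator (does (v ⟶? u))) ⟩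
    sum (λ u → sum (λ v → indicator (does (v ⟶? u))))    ≡⟨ sum-cong-≗ (λ u → ∣tabulate∣≡sum (λ v → does (v ⟶? u))) ⟨
    sum (outDegree (op D))                               ∎
    where open ≡-Reasoning

  -- Otherwise all out-degrees are at most 2, so all in-degrees are at least 2,
  -- and the sums of the two differ.
  balanced⇒2≤outDegree : 5 ≤ n → Balanced D → ∀ u → 2 ≤ outDegree D u
  balanced⇒2≤outDegree 5≤n bal u with 2 ≤? outDegree D u
  ... | yes 2≤ = 2≤
  ... | no  2≰ = contradiction strict (<-irrefl handshake)
    where
    out≤1 : outDegree D u ≤ 1
    out≤1 = s≤s⁻¹ (≰⇒> 2≰)
    out≤2 : ∀ v → outDegree D v ≤ 2
    out≤2 v = ≤-trans (bal v u) (s≤s out≤1)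
    -- Of at least 5 vertices, at most 2 are out-neighbours and one is `v` itself.
    2≤in : ∀ v → 2 ≤ outDegree (op D) v
    2≤in v = s≤s⁻¹ (+-cancelˡ-≤ 2 _ _ (≤-trans 5≤n
      (≤-trans (≤-reflexive (sym (outDegree+inDegree v))) (+-monoˡ-≤ _ (out≤2 v)))))
    strict : sum (outDegree D) < sum (outDegree (op D))
    strict = subst₂ _≤_ (+-comm _ 1) (+-identityʳ _)
      (sum-mono-at u (λ v _ → ≤-trans (out≤2 v) (2≤in v))
        (subst₂ _≤_ (+-comm 1 _) (sym (+-identityʳ _)) (≤-trans (s≤s out≤1) (2≤in u))))

  -- Out-neighbourhoods of vertex sets

  outUnion : Subset n → Subset n
  outUnion P = tabulate λ x → does (any? λ v → (v ∈? P) ×-dec (v ⟶? x))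

  ∈-outUnion⁺ : ∀ {P v x} → v ∈ P → v ⟶ x → x ∈ outUnion P
  ∈-outUnion⁺ {P} {x = x} v∈ a =
    ∈-tabulate⁺ (dec-true (any? λ v → (v ∈? P) ×-dec (v ⟶? x)) (_ , v∈ , a))

  ∈-outUnion⁻ : ∀ {P x} → x ∈ outUnion P → ∃ λ v → v ∈ P × (v ⟶ x)
  ∈-outUnion⁻ {P} {x} x∈ =
    does-true⁻ (any? λ v → (v ∈? P) ×-dec (v ⟶? x)) (∈-tabulate⁻ x∈)

  module _ (bal : Balanced D) (2≤out : ∀ v → 2 ≤ outDegree D v) where

    out-nonempty : ∀ v → ∃ (v ⟶_)
    out-nonempty v =
      let x , x∈ = 0<∣p∣⇒Nonempty (O D v) (≤-trans (s≤s z≤n) (2≤out v)) in x , ∈-O⁻ D x∈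

    -- At most one vertex w of P is missed by the union N, since such a w
    -- dominates P - w.  If N ⊆ P, then N = O(w) is closed under O, and a path
    -- w → p → q yields O(q) ⊆ O(w) ∖ {p, q}, against near regularity.
    ∣P∣≤∣outUnion∣ : ∀ P → ∣ P ∣ ≤ ∣ outUnion P ∣
    ∣P∣≤∣outUnion∣ P with any? (λ w → (w ∈? P) ×-dec ¬? (w ∈? outUnion P))
    ... | no none = p⊆q⇒∣p∣≤∣q∣ λ {x} x∈ →
            decidable-stable (x ∈? outUnion P) (λ x∉ → none (x , x∈ , x∉))
    ... | yes (w , w∈ , w∉) = ≤-trans (∣p∣≤1+∣p-x∣ P w) (p⊂q⇒∣p∣<∣q∣ (P-w⊆N , outside-P))
      where
      N = outUnion P
      w⟶ : ∀ {x} → x ∈ P → x ≢ w → w ⟶ x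
      w⟶ x∈ x≢w with total x≢w
      ... | inj₁ a = contradiction (∈-outUnion⁺ x∈ a) w∉
      ... | inj₂ a = a
      P-w⊆N : P - w ⊆ N
      P-w⊆N x∈′ = let x∈ , x≢w = x∈p-y⁻ P x∈′ in ∈-outUnion⁺ w∈ (w⟶ x∈ x≢w)
      outside-P : ∃ λ x → x ∈ N × x ∉ P - w
      outside-P with any? (λ x → (x ∈? N) ×-dec ¬? (x ∈? P))
      ... | yes (x , x∈ , x∉) = x , x∈ , x∉ ∘ proj₁ ∘ x∈p-y⁻ P
      ... | no none = contradiction (≤-trans (s≤s (s≤s ∣Oq∣≤)) (≤-trans ∣Ow∣≥ (bal w q))) 1+n≰n
        where
        N⊆P : N ⊆ P
        N⊆P {x} x∈ = decidable-stable (x ∈? P) (λ x∉ → none (x , x∈ , x∉))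
        w⟶N : ∀ {x} → x ∈ N → w ⟶ x
        w⟶N x∈ = w⟶ (N⊆P x∈) λ { refl → w∉ x∈ }
        p = proj₁ (out-nonempty w)
        p∈N : p ∈ N
        p∈N = ∈-outUnion⁺ w∈ (proj₂ (out-nonempty w))
        q = proj₁ (out-nonempty p)
        p⟶q = proj₂ (out-nonempty p)
        q∈N : q ∈ N
        q∈N = ∈-outUnion⁺ (N⊆P p∈N) p⟶q
        Ow = O D w
        ∣Oq∣≤ : outDegree D q ≤ ∣ Ow - p - q ∣
        ∣Oq∣≤ = p⊆q⇒∣p∣≤∣q∣ {p = O D q} {q = Ow - p - q} λ y∈ → let q⟶y = ∈-O⁻ D y∈ in
          x∈p∧x≢y⇒x∈p-y
            (x∈p∧x≢y⇒x∈p-y (∈-O⁺ D (w⟶N (∈-outUnion⁺ (N⊆P q∈N) q⟶y)))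
              λ { refl → asym p⟶q q⟶y })
            (arc⇒≢ q⟶y ∘ sym)
        ∣Ow∣≥ : suc (suc ∣ Ow - p - q ∣) ≤ outDegree D w
        ∣Ow∣≥ = ≤-trans
          (s≤s (x∈p⇒∣p-x∣<∣p∣ (x∈p∧x≢y⇒x∈p-y (∈-O⁺ D (w⟶N q∈N)) (arc⇒≢ p⟶q ∘ sym))))
          (x∈p⇒∣p-x∣<∣p∣ (∈-O⁺ D (w⟶N p∈N)))

    2≤∣outUnion∣ : ∀ {P} → Nonempty P → 2 ≤ ∣ outUnion P ∣
    2≤∣outUnion∣ (v , v∈) =
      ≤-trans (2≤out v) (p⊆q⇒∣p∣≤∣q∣ λ x∈ → ∈-outUnion⁺ v∈ (∈-O⁻ D x∈))

    -- Two out-neighbours of `u` are joined by an arc; its tail and `u` both dominate its head.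
    common-out : Fin n → ∃₂ λ u v → ∃ λ x → u ≢ v × (u ⟶ x) × (v ⟶ x)
    common-out u with 1<∣p∣⇒distinct (O D u) (2≤out u)
    ... | x , y , x∈ , y∈ , x≢y with total x≢y
    ...   | inj₁ x⟶y = u , x , y , arc⇒≢ (∈-O⁻ D x∈) , ∈-O⁻ D y∈ , x⟶y
    ...   | inj₂ y⟶x = u , y , x , arc⇒≢ (∈-O⁻ D y∈) , ∈-O⁻ D x∈ , y⟶x

-- Splitting vertex sets into classes

module Composition
  {l k : ℕ} (T′ : Digraph l) (Ts : Fin l → Digraph k) (T : Digraph (k * l))
  (comp : IsComposition T′ Ts T)
  where

  open Digraph T  using (_⟶_)
  open Digraph T′ using () renaming (_⟶_ to _⟶′_; _⟶?_ to _⟶′?_)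
  open IsComposition comp
  open Equivalence using (to; from)

  -- Pulled back along `copy i`, so that results on `Ts i` apply directly.
  part : Subset (k * l) → Fin l → Subset k
  part X i = tabulate λ a → lookup X (copy i a)

  ∈-part⁺ : ∀ {X i a} → copy i a ∈ X → a ∈ part X i
  ∈-part⁺ x∈ = ∈-tabulate⁺ ([]=⇒lookup x∈)

  ∈-part⁻ : ∀ {X i a} → a ∈ part X i → copy i a ∈ X
  ∈-part⁻ a∈ = lookup⇒[]= _ _ (∈-tabulate⁻ a∈)

  unpair : ∀ {i j a b} → i ≡ j → copy i a ≡ copy j b → (a , i) ≡ (b , j)
  unpair refl eq = cong (_, _) (copy-injective _ eq)

  -- Lists the vertices as pairs of a position and a class, which turns a sum over all vertices into
  -- a double sum.
  index : Permutation (k * l) (k * l)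
  index = mk↔ₛ′ (λ (a , i) → copy i a) (λ v → proj₁ (copy-onto v) , block v)
            (λ v → proj₂ (copy-onto v))
            (λ (a , i) → unpair (copy-block i a) (proj₂ (copy-onto (copy i a))))
          ↔-∘ *↔×

  ∣X∣≡∑∣part∣ : ∀ X → ∣ X ∣ ≡ sum (λ i → ∣ part X i ∣)
  ∣X∣≡∑∣part∣ X = begin
    ∣ X ∣
      ≡⟨ cong ∣_∣ (tabulate∘lookup X) ⟨
    ∣ tabulate (lookup X) ∣
      ≡⟨ ∣tabulate∣≡sum (lookup X) ⟩
    sum χ
      ≡⟨ sum-permute χ index ⟩
    sum (λ x → χ (copy′ (remQuot l x)))
      ≡⟨ sum-* k (χ ∘ copy′ ∘ remQuot l) ⟩
    sum (λ a → sum (λ i → χ (copy′ (remQuot l (combine {k} a i)))))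
      ≡⟨ sum-cong-≗ (λ a → sum-cong-≗ λ i → cong (χ ∘ copy′) (remQuot-combine a i)) ⟩
    sum (λ a → sum (λ i → χ (copy i a)))
      ≡⟨ ∑-comm (λ a i → χ (copy i a)) ⟩
    sum (λ i → sum (λ a → χ (copy i a)))
      ≡⟨ sum-cong-≗ (λ i → ∣tabulate∣≡sum (lookup X ∘ copy i)) ⟨
    sum (λ i → ∣ part X i ∣)
      ∎
    where
    open ≡-Reasoning
    χ : Fin (k * l) → ℕ
    χ = indicator ∘ lookup X
    copy′ : Fin k × Fin l → Fin (k * l)
    copy′ (a , i) = copy i a

  arc-across : ∀ {i j} a b → i ≢ j → i ⟶′ j → copy i a ⟶ copy j b
  arc-across {i} {j} a b i≢j i⟶j =
    from (across (copy i a) (copy j b)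
           (i≢j ∘ λ eq → trans (sym (copy-block i a)) (trans eq (copy-block j b))))
      (subst₂ _⟶′_ (sym (copy-block i a)) (sym (copy-block j b)) i⟶j)

  copy-≢ : ∀ {i j} a b → i ≢ j → copy i a ≢ copy j b
  copy-≢ {i} {j} a b i≢j eq =
    i≢j (trans (sym (copy-block i a)) (trans (cong block eq) (copy-block j b)))

  -- The composition is a tournament

  module _ (tour′ : IsTournament T′) (tours : ∀ i → IsTournament (Ts i)) where

    composition-isTournament : IsTournament T
    composition-isTournament = record { loopless = irr ; exactlyOne = one }
      where
      irr : ∀ {u v} → u ≡ v → ¬ (u ⟶ v)
      irr {u} refl a with copy-onto u
      ... | x , eq = IsTournament.loopless (tours (block u)) refl
                       (to (inside _ x x) (subst₂ _⟶_ (sym eq) (sym eq) a))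
      one-inside : ∀ {u v} i x y → copy i x ≡ u → copy i y ≡ v → u ≢ v →
                   (u ⟶ v × ¬ (v ⟶ u)) ⊎ (v ⟶ u × ¬ (u ⟶ v))
      one-inside i x y refl refl u≢v =
        [ (λ (a , ¬b) → inj₁ (from (inside i x y) a , ¬b ∘ to (inside i y x)))
        , (λ (b , ¬a) → inj₂ (from (inside i y x) b , ¬a ∘ to (inside i x y))) ]′
        (IsTournament.exactlyOne (tours i) (u≢v ∘ cong (copy i)))
      one : ∀ {u v} → u ≢ v → (u ⟶ v × ¬ (v ⟶ u)) ⊎ (v ⟶ u × ¬ (u ⟶ v))
      one {u} {v} u≢v with block u ≟ block v
      ... | yes eq = let a , a-u = copy-onto u ; b , b-v = copy-onto v in
        one-inside (block u) a b a-u (trans (cong (λ i → copy i b) eq) b-v) u≢v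
      ... | no ne =
        [ (λ (a , ¬b) → inj₁ (from (across u v ne) a , ¬b ∘ to (across v u (ne ∘ sym))))
        , (λ (b , ¬a) → inj₂ (from (across v u (ne ∘ sym)) b , ¬a ∘ to (across u v ne))) ]′
        (IsTournament.exactlyOne tour′ ne)

    module _ (2≤l : 2 ≤ l) (5≤k : 5 ≤ k) (strong : Strong T′) (bal : ∀ i → Balanced (Ts i)) where

      2≤out : ∀ i u → 2 ≤ outDegree (Ts i) u
      2≤out i = balanced⇒2≤outDegree (Ts i) (tours i) 5≤k (bal i)

      -- Bounds on common out-neighbours in each class

      module _ (S : Subset (k * l)) where

        -- Spelled as in `Quadrangular (O T)`, so that a bound on it is the required conclusion by
        -- definition.
        Q : Subset (k * l)
        Q = ⋃ (map (λ (u , v) → O T u ∩ O T v) (distinctPairs S))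

        ∈-Q⁺ : ∀ {u v x} → u ∈ S → v ∈ S → u ≢ v → u ⟶ x → v ⟶ x → x ∈ Q
        ∈-Q⁺ u∈ v∈ u≢v a b =
          ∈-⋃⁺ (∈-map⁺ (λ (u , v) → O T u ∩ O T v) (∈-distinctPairs⁺ u∈ v∈ u≢v))
               (x∈p∩q⁺ (∈-O⁺ T a , ∈-O⁺ T b))

        s q : Fin l → ℕ
        s i = ∣ part S i ∣
        q i = ∣ part Q i ∣

        s≤k : ∀ i → s i ≤ k
        s≤k i = ∣p∣≤n (part S i)

        k≤q : ∀ {i j} → i ⟶′ j → 2 ≤ s i → k ≤ q j
        k≤q {i} {j} i⟶j 2≤s with 1<∣p∣⇒distinct (part S i) 2≤s
        ... | x , y , x∈ , y∈ , x≢y =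
          subst (_≤ q j) (∣⊤∣≡n k) (p⊆q⇒∣p∣≤∣q∣ {p = ⊤} λ {b} _ → ∈-part⁺
            (∈-Q⁺ (∈-part⁻ x∈) (∈-part⁻ y∈) (x≢y ∘ copy-injective i) (arc x b) (arc y b)))
          where
          arc : ∀ a b → copy i a ⟶ copy j b
          arc a b = arc-across a b (arc⇒≢ T′ tour′ i⟶j) i⟶j

        -- A vertex of `S` in class `i` dominates all of class `j`, so it shares with each `b` of
        -- `S` in class `j` every out-neighbour of `b` there.
        outUnion⊆Q : ∀ {i j} → i ⟶′ j → 1 ≤ s i → outUnion (Ts j) (tours j) (part S j) ⊆ part Q j
        outUnion⊆Q {i} {j} i⟶j 1≤s x∈ 
          with 0<∣p∣⇒Nonempty (part S i) 1≤s | ∈-outUnion⁻ (Ts j) (tours j) x∈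
        ... | a , a∈ | b , b∈ , b⟶x =
          ∈-part⁺ (∈-Q⁺ (∈-part⁻ a∈) (∈-part⁻ b∈) (copy-≢ a b i≢j)
            (arc-across a _ i≢j i⟶j) (from (inside j b _) b⟶x))
          where
          i≢j = arc⇒≢ T′ tour′ i⟶j

        s≤q : ∀ {i j} → i ⟶′ j → 1 ≤ s i → s j ≤ q j
        s≤q {j = j} i⟶j 1≤s = ≤-trans
          (∣P∣≤∣outUnion∣ (Ts j) (tours j) (bal j) (2≤out j) (part S j))
          (p⊆q⇒∣p∣≤∣q∣ (outUnion⊆Q i⟶j 1≤s))

        2≤q : ∀ {i j} → i ⟶′ j → 1 ≤ s i → 1 ≤ s j → 2 ≤ q j
        2≤q {j = j} i⟶j 1≤si 1≤sj = ≤-trans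
          (2≤∣outUnion∣ (Ts j) (tours j) (bal j) (2≤out j) (0<∣p∣⇒Nonempty (part S j) 1≤sj))
          (p⊆q⇒∣p∣≤∣q∣ (outUnion⊆Q i⟶j 1≤si))

        s≡k⇒1≤q : ∀ {i} → 1 ≤ s i → s i ≡ k → 1 ≤ q i
        s≡k⇒1≤q {i} 1≤s s≡k with
          common-out (Ts i) (tours i) (bal i) (2≤out i) (proj₁ (0<∣p∣⇒Nonempty (part S i) 1≤s))
        ... | u , v , x , u≢v , u⟶x , v⟶x = x∈p⇒0<∣p∣ (∈-part⁺
          (∈-Q⁺ (∈-part⁻ (full u)) (∈-part⁻ (full v)) (u≢v ∘ copy-injective i)
            (from (inside i u x) u⟶x) (from (inside i v x) v⟶x)))
          where
          full : ∀ x → x ∈ part S i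
          full x = subst (x ∈_) (sym (∣p∣≡n⇒p≡⊤ s≡k)) ∈⊤

        -- Either `s i < k`, or `S` contains the whole class and `common-out` puts a vertex of the
        -- class into `Q`. The extra 1 pays for one vertex of `S` in a class filled by `Q`.
        s+1≤q+k : ∀ i → 1 ≤ s i → s i + 1 ≤ q i + k
        s+1≤q+k i 1≤s with m≤n⇒m<n∨m≡n (s≤k i)
        ... | inj₁ s<k = ≤-trans (≤-reflexive (+-comm _ 1)) (≤-trans s<k (m≤n+m k (q i)))
        ... | inj₂ s≡k = ≤-trans (≤-reflexive (+-comm _ 1)) (+-mono-≤ (s≡k⇒1≤q 1≤s s≡k) (s≤k i))

        -- Compensating for an undominated class

        Source : Pred (Fin l) 0ℓ
        Source j = 1 ≤ s j × (∀ i → i ⟶′ j → s i ≡ 0)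

        module _ {j₀} (source : Source j₀) where

          1≤s₀ = proj₁ source

          -- An arc from `j` to the source would force `s j` to be 0. Hence the source is unique,
          -- and it dominates every other class meeting `S`.
          from-source : ∀ {j} → j ≢ j₀ → 1 ≤ s j → j₀ ⟶′ j
          from-source j≢ 1≤s with total T′ tour′ j≢
          ... | inj₂ a = a
          ... | inj₁ a = contradiction (subst (1 ≤_) (proj₂ source _ a) 1≤s) λ ()

          not-to-source : ∀ {j m} → 1 ≤ s j → j ⟶′ m → m ≢ j₀
          not-to-source 1≤s a refl = contradiction (subst (1 ≤_) (proj₂ source _ a) 1≤s) λ ()

          s≤q-off-source : ∀ j → j ≢ j₀ → s j ≤ q j
          s≤q-off-source j j≢ with 1 ≤? s j
          ... | yes 1≤s = s≤q (from-source j≢ 1≤s) 1≤s₀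
          ... | no  1≰s = ≤-trans (s≤s⁻¹ (≰⇒> 1≰s)) z≤n

          Compensates : Pred (Fin l) 0ℓ
          Compensates j = j ≢ j₀ × s j₀ + s j ≤ q j₀ + q j

          empty-full-compensates : ∀ {j} → j ≢ j₀ → s j ≡ 0 → k ≤ q j → Compensates j
          empty-full-compensates {j} j≢ s≡0 k≤ = j≢ , (begin
            s j₀ + s j  ≡⟨ cong (s j₀ +_) s≡0 ⟩
            s j₀ + 0    ≡⟨ +-identityʳ _ ⟩
            s j₀        ≤⟨ ≤-trans (s≤k j₀) k≤ ⟩
            q j         ≤⟨ m≤n+m _ _ ⟩
            q j₀ + q j  ∎)
            where open ≤-Reasoning

          -- Take an arc from `j` to `m` leaving the out-neighbourhood of `j₀`. If `s j` is at least
          -- 2, then `m` is not the source, misses `S` and is filled by `Q`. Otherwise `j` works: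
          -- `Q` fills it and `S` has at most one vertex there.
          compensator-large : 2 ≤ s j₀ → ∃ Compensates
          compensator-large 2≤s₀ = result
            where
            first-step : ∃ λ j → j₀ ⟶′ j
            -- A second class exists as `2 ≤ l`, and a path to it must leave `j₀`.
            first-step with another 2≤l j₀
            ... | i , i≢ with Star-exit (_≟ j₀) (strong j₀ i) refl i≢
            ...   | _ , j , a , refl , _ = j , a
            result : ∃ Compensates
            result with Star-exit (j₀ ⟶′?_) (strong (proj₁ first-step) j₀) (proj₂ first-step)
                          (λ a → arc⇒≢ T′ tour′ a refl)
            ... | j , m , j⟶m , j₀⟶j , j₀↛m with 2 ≤? s j
            ...   | yes 2≤s = m , empty-full-compensates m≢ s≡0 (k≤q j⟶m 2≤s)
              where
              m≢ = not-to-source (≤-trans (s≤s z≤n) 2≤s) j⟶m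
              s≡0 : s m ≡ 0
              s≡0 = n<1⇒n≡0 (≰⇒> (j₀↛m ∘ from-source m≢))
            ...   | no 2≰s = j , arc⇒≢ T′ tour′ j₀⟶j ∘ sym ,
                      ≤-trans (+-monoʳ-≤ (s j₀) (s≤s⁻¹ (≰⇒> 2≰s)))
                        (≤-trans (s+1≤q+k j₀ 1≤s₀) (+-monoʳ-≤ (q j₀) (k≤q j₀⟶j 2≤s₀)))

          -- Take an arc from `j` to `m` leaving the set of classes other than `j₀` that meet `S`.
          -- If `s j` is at least 2, then `m` misses `S` and is filled by `Q`. Otherwise
          -- `s j₀ + s j` is at most 2, and `q j` alone covers it.
          compensator-single : s j₀ ≡ 1 → ∃ (λ j → j ≢ j₀ × 1 ≤ s j) → ∃ Compensates
          compensator-single s₀≡1 (j′ , j′≢ , 1≤s′)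
            with Star-exit (λ j → ¬? (j ≟ j₀) ×-dec (1 ≤? s j)) (strong j′ j₀)
                   (j′≢ , 1≤s′) (λ p → proj₁ p refl)
          ... | j , m , j⟶m , (j≢ , 1≤s) , ¬m with 2 ≤? s j
          ...   | yes 2≤s = m , empty-full-compensates m≢ (n<1⇒n≡0 (≰⇒> (¬m ∘ (m≢ ,_)))) (k≤q j⟶m 2≤s)
            where
            m≢ = not-to-source 1≤s j⟶m
          ...   | no 2≰s = j , j≢ ,
                    ≤-trans (+-mono-≤ (≤-reflexive s₀≡1) (s≤s⁻¹ (≰⇒> 2≰s)))
                      (≤-trans (2≤q (from-source j≢ 1≤s) 1≤s₀ 1≤s) (m≤n+m (q j) (q j₀)))

        -- Comparing the sizes of `S` and `Q`

        part-⊆ : ∀ {v} → v ∈ S → proj₁ (copy-onto v) ∈ part S (block v)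
        part-⊆ {v} v∈ = ∈-part⁺ (subst (_∈ S) (sym (proj₂ (copy-onto v))) v∈)

        -- The mate of the only vertex of `S` in class `j` must lie in another class.
        other-class : ∀ {j} → s j ≡ 1 → (∀ u → u ∈ S → ∃ λ v → v ∈ S × v ≢ u) →
                      ∃ λ i → i ≢ j × 1 ≤ s i
        other-class {j} s≡1 mate with 0<∣p∣⇒Nonempty (part S j) (≤-reflexive (sym s≡1))
        ... | a , a∈ with mate (copy j a) (∈-part⁻ a∈)
        ...   | v , v∈ , v≢ = block v , block≢ , x∈p⇒0<∣p∣ (part-⊆ v∈)
          where
          block≢ : block v ≢ j
          block≢ refl = contradiction
            (subst (2 ≤_) s≡1 (distinct⇒1<∣p∣ a∈ (part-⊆ v∈)
              (λ eq → v≢ (trans (sym (proj₂ (copy-onto v))) (cong (copy j) (sym eq))))))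
            λ { (s≤s ()) }

        ∣S∣≤∣Q∣ : (∀ u → u ∈ S → ∃ λ v → v ∈ S × v ≢ u) → ∣ S ∣ ≤ ∣ Q ∣
        ∣S∣≤∣Q∣ mate = subst₂ _≤_ (sym (∣X∣≡∑∣part∣ S)) (sym (∣X∣≡∑∣part∣ Q)) ∑s≤∑q
          where
          dominated? = λ j → any? (λ i → (i ⟶′? j) ×-dec (1 ≤? s i))
          ∑s≤∑q : sum s ≤ sum q
          ∑s≤∑q with any? (λ j → (1 ≤? s j) ×-dec ¬? (dominated? j))
          ... | no none = sum-mono bound
            where
            bound : ∀ j → s j ≤ q j
            bound j with 1 ≤? s j | dominated? j
            ... | no 1≰s | _ = ≤-trans (s≤s⁻¹ (≰⇒> 1≰s)) z≤n
            ... | yes _ | yes (i , i⟶j , 1≤s) = s≤q i⟶j 1≤s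
            ... | yes 1≤s | no undominated = contradiction (j , 1≤s , undominated) none
          ... | yes (j₀ , 1≤s₀ , undominated) =
            -- Classes other than `j₀` are compared termwise, and `j₀` is compared jointly with its
            -- compensator.
            let j , j≢ , pair = compensator in sum-mono-pair j≢ (s≤q-off-source source) pair
            where
            source : Source j₀
            source = 1≤s₀ , λ i a → n<1⇒n≡0 (≰⇒> λ 1≤s → undominated (i , a , 1≤s))
            compensator : ∃ (Compensates source)
            compensator with m≤n⇒m<n∨m≡n 1≤s₀
            ... | inj₁ 2≤s₀ = compensator-large source 2≤s₀
            ... | inj₂ 1≡s₀ = compensator-single source (sym 1≡s₀) (other-class (sym 1≡s₀) mate)

      quadrangular : Quadrangular (O T)
      quadrangular S common =
        ∣S∣≤∣Q∣ S λ u u∈ → let v , v∈ , v≢u , _ = common u u∈ in v , v∈ , v≢u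

-- The bound `2 ≤ l` excludes a false case: with one class, let `T` be the regular tournament on the
-- residues mod 5 in which `i` dominates `i+1` and `i+2`. The vertices 0 and 1 then have only the
-- common out-neighbour 2.
theorem3p1 : (l k : ℕ) → 2 ≤ l → 5 ≤ k →
    (T′ : Digraph l) → IsTournament T′ → Strong T′ →
    (Ts : Fin l → Digraph k) → (∀ i → IsTournament (Ts i)) →
    (∀ i → Regular (Ts i) ⊎ NearRegular (Ts i)) →
    (T : Digraph (k * l)) → IsComposition T′ Ts T →
    IsTournament T × StronglyQuadrangular T
theorem3p1 l k 2≤l 5≤k T′ tour′ strong Ts tours reg T comp =
    F.composition-isTournament tour′ tours
  , F.quadrangular tour′ tours 2≤l 5≤k strong bal
  -- `O (op T)` unfolds to `I T`, so the result for the reversed composition is the second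
  -- condition.
  , B.quadrangular (op-isTournament tour′) (λ i → op-isTournament (tours i)) 2≤l 5≤k
      (op-strong T′ strong) (λ i → op-balanced (Ts i) (tours i) (bal i))
  where
  module F = Composition T′ Ts T comp
  module B = Composition (op T′) (op ∘ Ts) (op T) (op-isComposition comp)
  bal : ∀ i → Balanced (Ts i)
  bal i = regular⇒balanced (Ts i) (reg i)
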